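{- For all constants $a,c>0$ there is a constant $C>0$ such that for every integer $n\ge 2$ and every $f:\{0,1\}^n\to\{0,1\}$ computed by a DNF formula of width at most $a\log n$, there is a DNF formula $g$ on the same $n$ variables of width at most $C\log n$ and with at most $n^{C\log\log n}$ terms such that $\Pr_{x}[f(x)\ne g(x)]\le n^{ -c}$, where $x$ is uniform in $\{0,1\}^n$.
   Context: A DNF formula is an OR of terms, each term being an AND of literals; its width is the maximum number of literals in a term. The empty term is the constant $1$ and the empty OR is the constant $0$. Convention: $\log(y)$ is read as $\max\{2,\log_2 y\}$ (so $\log\log n\ge 2$). -}

module Defs where

open import Data.Bool using (Bool; not; if_then_else_)
open import Data.Fin using (Fin)
open import Data.Integer as ℤ using (+_)
import Data.Integer.Properties as ℤ
open import Data.List using (List; []; _∷_; map; foldr; filter; length; _++_; all; any)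
open import Data.Nat as ℕ using (ℕ; zero; suc; NonZero)
import Data.Nat.Properties as ℕ
open import Data.Product using (∃; ∃₂; ∃-syntax; _×_; _,_; proj₁)
open import Data.Rational.Unnormalised
  using (ℚᵘ; mkℚᵘ; ↥_; ↧ₙ_; _/_; _≤_; _<_; _*_; 0ℚᵘ; 1ℚᵘ; *≤*; Positive; positive; NonNegative; 1/_;
         +-*-rawSemiring)
open import Data.Rational.Unnormalised.Properties
  using (≤-refl; ≤-trans; ≤-reflexive; <⇒≤; ≮⇒≥; <-irrefl; ≤-<-trans; <-≤-trans; ≃-refl; ≃-sym;
         *-mono-≤-nonNeg; *-monoʳ-≤-nonNeg; *-cancelʳ-≤-pos; *-identityʳ;
         pos⇒nonNeg; pos⇒nonZero; pos*pos⇒pos; positive⁻¹; *-inverseˡ;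
         module ≤-Reasoning)
open import Data.Vec as Vec using (Vec; lookup)
open import Algebra.Definitions.RawSemiring +-*-rawSemiring using (_^_)
open import Level using (0ℓ)
open import Relation.Binary.PropositionalEquality using (_≡_; refl; sym; cong; subst₂)
open import Relation.Unary using (Pred; Decidable)

------------------------------------------------------------------------
-- Boolean formulas

-- (i , true) is the literal xᵢ and (i , false) is its negation.
Literal : ℕ → Set
Literal n = Fin n × Bool

Term : ℕ → Set
Term n = List (Literal n)

DNF : ℕ → Set
DNF n = List (Term n)

evalLiteral : ∀ {n} → Vec Bool n → Literal n → Bool
evalLiteral x (i , b) = if b then lookup x i else not (lookup x i)

evalTerm : ∀ {n} → Vec Bool n → Term n → Bool
evalTerm x t = all (evalLiteral x) t

eval : ∀ {n} → DNF n → Vec Bool n → Bool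
eval F x = any (evalTerm x) F

_computes_ : ∀ {n} → DNF n → (Vec Bool n → Bool) → Set
F computes f = ∀ x → eval F x ≡ f x

width : ∀ {n} → DNF n → ℕ
width F = foldr ℕ._⊔_ 0 (map length F)

------------------------------------------------------------------------
-- Uniform probability on the cube

cube : ∀ n → List (Vec Bool n)
cube zero    = Vec.[] ∷ []
cube (suc n) = map (Bool.false Vec.∷_) (cube n) ++ map (Bool.true Vec.∷_) (cube n)

Pr : ∀ {n} {P : Pred (Vec Bool n) 0ℓ} → Decidable P → ℚᵘ
Pr {n} P? = _/_ (+ length (filter P? (cube n))) (2 ℕ.^ n) {{ℕ.m^n≢0 2 n}}

------------------------------------------------------------------------
-- Positive real numbers

-- A positive real x is presented by a set of rationals whose infimum is x:
-- any inhabited set with a positive rational lower bound.  The set need not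
-- be upward closed or open (neither changes the infimum), so a real has many
-- presentations; everything below depends only on the infima.  Classically
-- these are exactly the positive reals.

record ℝ⁺ : Set₁ where
  field
    Above     : ℚᵘ → Set
    inhabited : ∃ Above
    bounded   : ∃[ ε ] Positive ε × (∀ {t} → Above t → ε ≤ t)

open ℝ⁺ public

infix 4 _≤ℝ_

_≤ℝ_ : ℚᵘ → ℝ⁺ → Set
q ≤ℝ x = ∀ {t} → Above x t → q ≤ t

fromℕ : ℕ → ℚᵘ
fromℕ k = + k / 1

1≤⇒pos : ∀ {q} → 1ℚᵘ ≤ q → Positive q
1≤⇒pos 1≤q = positive (<-≤-trans (positive⁻¹ 1ℚᵘ) 1≤q)

fromℕ-mono : ∀ {j k} → j ℕ.≤ k → fromℕ j ≤ fromℕ k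
fromℕ-mono {j} {k} j≤k = *≤* (ℤ.*-monoʳ-≤-nonNeg (+ 1) (ℤ.+≤+ j≤k))

*-mono : ∀ {p q r s} → Positive p → Positive r → p ≤ q → r ≤ s → p * r ≤ q * s
*-mono {p} {r = r} p>0 r>0 =
  *-mono-≤-nonNeg {{pos⇒nonNeg p {{p>0}}}} {{pos⇒nonNeg r {{r>0}}}}

Above⇒pos : ∀ (x : ℝ⁺) {t} → Above x t → Positive t
Above⇒pos x t∈x with bounded x
... | ε , ε>0 , lb = positive (<-≤-trans (positive⁻¹ ε {{ε>0}}) (lb t∈x))

fromℕ⁺ : (n : ℕ) .{{_ : NonZero n}} → ℝ⁺
fromℕ⁺ n = record
  { Above     = λ t → fromℕ n ≤ t
  ; inhabited = fromℕ n , ≤-refl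
  ; bounded   = 1ℚᵘ , _ , ≤-trans (fromℕ-mono {1} {n} (ℕ.>-nonZero⁻¹ n))
  }

infixl 7 _*ℝ_

_*ℝ_ : ℝ⁺ → ℝ⁺ → ℝ⁺
x *ℝ y = record
  { Above     = λ t → ∃₂ λ r s → Above x r × Above y s × r * s ≤ t
  ; inhabited = let r , r∈x = inhabited x
                    s , s∈y = inhabited y
                in r * s , r , s , r∈x , s∈y , ≤-refl
  ; bounded   = let δ , δ>0 , δ≤x = bounded x
                    ε , ε>0 , ε≤y = bounded y
                in δ * ε , pos*pos⇒pos δ {{δ>0}} ε {{ε>0}} ,
                   λ (_ , _ , r∈x , s∈y , rs≤t) →
                     ≤-trans (*-mono δ>0 ε>0 (δ≤x r∈x) (ε≤y s∈y)) rs≤t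
  }

-- 1/x is the infimum of 1/p over the positive rationals p ≤ x.
infix 8 _⁻¹

_⁻¹ : ℝ⁺ → ℝ⁺
x ⁻¹ = record
  { Above     = λ t → ∃[ p ] Positive p × p ≤ℝ x × 1ℚᵘ ≤ t * p
  ; inhabited = let ε , ε>0 , ε≤x = bounded x
                    instance
                      _ = ε>0
                      _ = pos⇒nonZero ε
                in 1/ ε , ε , ε>0 , ε≤x , ≤-reflexive (≃-sym (*-inverseˡ ε))
  ; bounded   = lower
  }
  where
  lower : ∃[ δ ] Positive δ ×
    (∀ {t} → (∃[ p ] Positive p × p ≤ℝ x × 1ℚᵘ ≤ t * p) → δ ≤ t)
  lower with inhabited x
  ... | u@(mkℚᵘ (+ suc k) d) , u∈x = 1/ u , _ , λ {t} → below t
    where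
    below : ∀ t → (∃[ p ] Positive p × p ≤ℝ x × 1ℚᵘ ≤ t * p) → 1/ u ≤ t
    below t (p , p>0 , p≤x , 1≤tp) = *-cancelʳ-≤-pos u (begin
      1/ u * u  ≃⟨ *-inverseˡ u ⟩
      1ℚᵘ       ≤⟨ 1≤tp ⟩
      t * p     ≤⟨ *-mono-nn (p≤x u∈x) ⟩
      t * u     ∎)
      where
      open ≤-Reasoning
      t≥0 : ∀ t p → Positive p → 1ℚᵘ ≤ t * p → NonNegative t
      t≥0 (mkℚᵘ (+ _) _) _ _ _ = _
      t≥0 (mkℚᵘ (ℤ.-[1+ _ ]) _) (mkℚᵘ (+ suc _) _) _ (*≤* ())
      *-mono-nn : p ≤ u → t * p ≤ t * u
      *-mono-nn = *-monoʳ-≤-nonNeg t {{t≥0 t p p>0 1≤tp}}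
  ... | u@(mkℚᵘ (+ 0) d) , u∈x with () ← Above⇒pos x u∈x
  ... | u@(mkℚᵘ (ℤ.-[1+ _ ]) d) , u∈x with () ← Above⇒pos x u∈x

-- n ^ x for real x > 0 and n ≥ 1.  For positive rationals r and t with
-- r = p / d, the condition n ^ r ≤ t is expressed as n ^ p ≤ t ^ d.
infixr 8 _^ℝ_

_^ℝ_ : (n : ℕ) .{{_ : NonZero n}} → ℝ⁺ → ℝ⁺
n ^ℝ x = record
  { Above     = λ t → Positive t × ∃[ r ] Above x r × fromℕ n ^ ℤ.∣ ↥ r ∣ ≤ t ^ ↧ₙ r
  ; inhabited = let r , r∈x = inhabited x
                    1≤b = 1≤^ 1≤n ℤ.∣ ↥ r ∣
                in fromℕ n ^ ℤ.∣ ↥ r ∣ , 1≤⇒pos 1≤b , r , r∈x ,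
                   q≤q^1+k 1≤b (ℚᵘ.denominator-1 r)
  ; bounded   = 1ℚᵘ , _ , λ {t} (t>0 , r , _ , le) →
                  ≮⇒≥ λ t<1 → <-irrefl ≃-refl
                    (≤-<-trans (≤-trans (1≤^ 1≤n ℤ.∣ ↥ r ∣) le)
                                (q^1+k<1 t>0 t<1 (ℚᵘ.denominator-1 r)))
  }
  where
  1≤n : 1ℚᵘ ≤ fromℕ n
  1≤n = fromℕ-mono {1} {n} (ℕ.>-nonZero⁻¹ n)

  1≤^ : ∀ {q} → 1ℚᵘ ≤ q → ∀ k → 1ℚᵘ ≤ q ^ k
  1≤^ 1≤q zero    = ≤-refl
  1≤^ 1≤q (suc k) = *-mono {1ℚᵘ} {r = 1ℚᵘ} _ _ 1≤q (1≤^ 1≤q k)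

  q≤q^1+k : ∀ {q} → 1ℚᵘ ≤ q → ∀ k → q ≤ q ^ suc k
  q≤q^1+k {q} 1≤q k = ≤-trans (≤-reflexive (≃-sym (*-identityʳ q)))
    (*-mono (1≤⇒pos 1≤q) _ (≤-refl {q}) (1≤^ 1≤q k))

  0<^ : ∀ {q} → Positive q → ∀ k → Positive (q ^ k)
  0<^ q>0 zero        = _
  0<^ {q} q>0 (suc k) = pos*pos⇒pos q {{q>0}} (q ^ k) {{0<^ q>0 k}}

  ^≤1 : ∀ {q} → Positive q → q ≤ 1ℚᵘ → ∀ k → q ^ k ≤ 1ℚᵘ
  ^≤1 q>0 q≤1 zero    = ≤-refl
  ^≤1 q>0 q≤1 (suc k) = *-mono q>0 (0<^ q>0 k) q≤1 (^≤1 q>0 q≤1 k)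

  q^1+k<1 : ∀ {q} → Positive q → q < 1ℚᵘ → ∀ k → q ^ suc k < 1ℚᵘ
  q^1+k<1 {q} q>0 q<1 k = ≤-<-trans
    (≤-trans (*-mono q>0 (0<^ q>0 k) (≤-refl {q}) (^≤1 q>0 (<⇒≤ q<1) k))
             (≤-reflexive (*-identityʳ q)))
    q<1

-- max {2, log₂ y}: the infimum of the rationals t ≥ 2 with y ≤ 2 ^ t.  For
-- t = p / d and u ∈ Above y, the condition u ≤ 2 ^ t is expressed as
-- u ^ d ≤ 2 ^ p.
log : ℝ⁺ → ℝ⁺
log y = record
  { Above     = λ t → fromℕ 2 ≤ t × ∃[ u ] Above y u × u ^ ↧ₙ t ≤ fromℕ 2 ^ ℤ.∣ ↥ t ∣
  ; inhabited = let u , u∈y = inhabited y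
                    k = ℤ.∣ ↥ u ∣
                in fromℕ (2 ℕ.+ k) , fromℕ-mono (ℕ.m≤m+n 2 k) , u , u∈y ,
                   ≤-trans (≤-reflexive (*-identityʳ u))
                     (≤-trans (u≤2^ u (Above⇒pos y u∈y)) (2^k≤2^2+k k))
  ; bounded   = fromℕ 2 , _ , proj₁
  }
  where
  2^≡ : ∀ k → fromℕ 2 ^ k ≡ fromℕ (2 ℕ.^ k)
  2^≡ zero    = refl
  2^≡ (suc k) rewrite 2^≡ k = cong (λ z → mkℚᵘ z 0) (sym (ℤ.pos-* 2 (2 ℕ.^ k)))

  k≤2^k : ∀ k → k ℕ.≤ 2 ℕ.^ k
  k≤2^k zero    = ℕ.z≤n
  k≤2^k (suc k) = ℕ.≤-trans (ℕ.+-mono-≤ (ℕ.m^n>0 2 k) (k≤2^k k))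
    (ℕ.≤-reflexive (cong (2 ℕ.^ k ℕ.+_) (sym (ℕ.+-identityʳ (2 ℕ.^ k)))))

  u≤2^ : ∀ u → Positive u → u ≤ fromℕ 2 ^ ℤ.∣ ↥ u ∣
  u≤2^ (mkℚᵘ (+ suc k) d) _ rewrite 2^≡ (suc k) =
    *≤* (scale (k≤2^k (suc k)))
    where
    scale : ∀ {a b} → a ℕ.≤ b → + a ℤ.* + 1 ℤ.≤ + b ℤ.* + suc d
    scale {a} {b} a≤b rewrite sym (ℤ.pos-* a 1) | sym (ℤ.pos-* b (suc d)) =
      ℤ.+≤+ (ℕ.*-mono-≤ a≤b (ℕ.s≤s ℕ.z≤n))

  2^k≤2^2+k : ∀ k → fromℕ 2 ^ k ≤ fromℕ 2 ^ (2 ℕ.+ k)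
  2^k≤2^2+k k = subst₂ _≤_ (sym (2^≡ k)) (sym (2^≡ (2 ℕ.+ k)))
    (fromℕ-mono (ℕ.^-monoʳ-≤ 2 (ℕ.m≤n+m k 2)))

{-# OPTIONS --safe #-}
module Submission where

-- Keep those terms of F that are, with probability at least δ, the first term
-- satisfied by a random point.  At most 1/δ terms are kept, and an error forces
-- a dropped term to be the first one satisfied, so the error is at most the sum
-- of the probabilities pᵢ < δ.  Let Pᵢ be the probability that a random
-- restriction (a variable is free with probability 1/2) can be completed to a
-- point whose first satisfied term is the i-th.  By induction on the dimension,
-- pᵢ ≤ Pᵢ².  Setting the free variables of the i-th term so as to satisfy it
-- turns such a restriction into one whose first forced term is the i-th, at the
-- cost of a factor 3 per variable, so Σ Pᵢ ≤ 3ʷ.  Hence the error is at most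
-- √δ Σ Pᵢ ≤ √δ 3ʷ, and δ = (3ʷ 2ᵉ)⁻² makes it at most 2⁻ᵉ.  For w and e of order
-- log n there remain n^O(1) terms, so log log n ≥ 2 suffices.

open import Defs
open import Data.Bool using (Bool; true; false; T; not; _∧_; _∨_; if_then_else_; _≟_)
open import Data.Bool.ListAction using (all; any)
open import Data.Bool.Properties using (T-∧; T-∨; not-¬)
open import Data.Empty using (⊥-elim)
open import Data.Fin as Fin using (Fin; zero; suc)
open import Data.Integer as ℤ using (+_; -[1+_])
import Data.Integer.Properties as ℤ
open import Data.List using (List; []; _∷_; _++_; map; length; filter; filterᵇ)
open import Data.List.Properties using (length-++; length-map; filter-++; length-filter)
open import Data.Maybe using (Maybe; just; nothing; maybe)
open import Data.Maybe.Relation.Unary.All using (All; just; nothing)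
open import Data.Nat as ℕ using (ℕ; zero; suc; NonZero; _+_; _*_; _^_; _≤_; _<_; z≤n; s≤s; _≤?_)
open import Data.Nat.Properties hiding (_≟_)
open import Data.Nat.Tactic.RingSolver using (solve-∀)
open import Data.Product using (Σ-syntax; ∃-syntax; _×_; _,_; proj₁; proj₂)
open import Data.Rational.Unnormalised as ℚ
  using (ℚᵘ; mkℚᵘ; ↥_; ↧ₙ_; 1ℚᵘ; Positive; *≤*; +-*-rawSemiring)
import Data.Rational.Unnormalised.Properties as ℚ
open import Data.Sum using (_⊎_; inj₁; inj₂)
open import Data.Vec as Vec using (Vec; []; _∷_; lookup; _[_]≔_)
open import Data.Vec.Properties using (lookup∘updateAt; lookup∘updateAt′)
open import Data.Vec.Relation.Binary.Pointwise.Inductive as Pointwise using (Pointwise; []; _∷_)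
open import Algebra.Definitions.RawSemiring +-*-rawSemiring using () renaming (_^_ to _^ℚ_)
open import Function using (_∘_)
open import Function.Bundles using (Equivalence)
open import Level using (0ℓ)
open import Relation.Binary.PropositionalEquality
  using (_≡_; refl; sym; trans; cong; cong₂; subst; subst₂)
open import Relation.Nullary using (¬_; yes; no; contradiction)
open import Relation.Nullary.Decidable using (¬?)
open import Relation.Unary using (Pred; Decidable)

open Equivalence using (to; from)

private variable
  n : ℕ
  X Y : Set

T-not⁻ : ∀ {b} → T (not b) → ¬ T b
T-not⁻ {false} _ ()

-- Counting

# : (X → Bool) → List X → ℕ
# p xs = length (filterᵇ p xs)

#-disjoint : ∀ {p q r : X → Bool} → (∀ x → T (q x) → ¬ T (r x)) →
  (∀ x → T (q x) → T (p x)) → (∀ x → T (r x) → T (p x)) →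
  ∀ xs → # q xs + # r xs ≤ # p xs
#-disjoint d f g [] = z≤n
#-disjoint {p = p} {q} {r} d f g (x ∷ xs)
  with p x | q x | r x | d x | f x | g x | #-disjoint {p = p} {q} {r} d f g xs
... | true  | true  | true  | c | _ | _ | _  = ⊥-elim (c _ _)
... | true  | true  | false | _ | _ | _ | ih = s≤s ih
... | true  | false | true  | _ | _ | _ | ih = ≤-trans (≤-reflexive (+-suc _ _)) (s≤s ih)
... | true  | false | false | _ | _ | _ | ih = m≤n⇒m≤1+n ih
... | false | true  | _     | _ | c | _ | _  = ⊥-elim (c _)
... | false | false | true  | _ | _ | c | _  = ⊥-elim (c _)
... | false | false | false | _ | _ | _ | ih = ih

#-∪ : ∀ {p q r : X → Bool} → (∀ x → T (p x) → T (q x) ⊎ T (r x)) →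
  ∀ xs → # p xs ≤ # q xs + # r xs
#-∪ h [] = z≤n
#-∪ {p = p} {q} {r} h (x ∷ xs) with p x | q x | r x | h x | #-∪ {p = p} {q} {r} h xs
... | true  | true  | true  | _ | ih = s≤s (≤-trans ih (+-monoʳ-≤ _ (n≤1+n _)))
... | true  | true  | false | _ | ih = s≤s ih
... | true  | false | true  | _ | ih = ≤-trans (s≤s ih) (≤-reflexive (sym (+-suc _ _)))
... | true  | false | false | c | _  with c _
... | inj₁ ()
... | inj₂ ()
#-∪ h (x ∷ xs) | false | true  | true  | _ | ih =
  m≤n⇒m≤1+n (≤-trans ih (+-monoʳ-≤ _ (n≤1+n _)))
#-∪ h (x ∷ xs) | false | true  | false | _ | ih = m≤n⇒m≤1+n ih
#-∪ h (x ∷ xs) | false | false | true  | _ | ih = ≤-trans ih (+-monoʳ-≤ _ (n≤1+n _))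
#-∪ h (x ∷ xs) | false | false | false | _ | ih = ih

#-false : (xs : List X) → # (λ _ → false) xs ≡ 0
#-false [] = refl
#-false (x ∷ xs) = #-false xs

#-mono : ∀ {p q : X → Bool} → (∀ x → T (p x) → T (q x)) → ∀ xs → # p xs ≤ # q xs
#-mono {p = p} h xs = subst (# p xs ≤_)
  (trans (cong (λ k → # _ xs + k) (#-false xs)) (+-identityʳ _))
  (#-∪ {r = λ _ → false} (λ x px → inj₁ (h x px)) xs)

#-++ : ∀ (p : X → Bool) xs ys → # p (xs ++ ys) ≡ # p xs + # p ys
#-++ p xs ys = trans (cong length (filter-++ _ xs ys)) (length-++ (filterᵇ p xs))

#-map : ∀ (p : Y → Bool) (f : X → Y) xs → # p (map f xs) ≡ # (p ∘ f) xs
#-map p f [] = refl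
#-map p f (x ∷ xs) with p (f x)
... | true  = cong suc (#-map p f xs)
... | false = #-map p f xs

#-≤length : ∀ (p : X → Bool) xs → # p xs ≤ length xs
#-≤length p xs = length-filter _ xs

length-filter≤# : ∀ {P : Pred X 0ℓ} (P? : Decidable P) {p : X → Bool} →
  (∀ x → P x → T (p x)) → ∀ xs → length (filter P? xs) ≤ # p xs
length-filter≤# P? h [] = z≤n
length-filter≤# P? {p} h (x ∷ xs) with P? x | p x | h x | length-filter≤# P? {p} h xs
... | yes _  | true  | _ | ih = s≤s ih
... | yes Px | false | c | _  = ⊥-elim (c Px)
... | no _   | true  | _ | ih = m≤n⇒m≤1+n ih
... | no _   | false | _ | ih = ih

#-cube : (p : Vec Bool (suc n) → Bool) →
  # p (cube (suc n)) ≡ # (p ∘ (false ∷_)) (cube n) + # (p ∘ (true ∷_)) (cube n)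
#-cube {n} p = trans (#-++ p (map (false ∷_) (cube n)) (map (true ∷_) (cube n)))
  (cong₂ _+_ (#-map p _ (cube n)) (#-map p _ (cube n)))

length-cube : ∀ n → length (cube n) ≡ 2 ^ n
length-cube zero = refl
length-cube (suc n) = trans (length-++ (map _ (cube n)))
  (cong₂ _+_ half (trans half (sym (+-identityʳ _))))
  where
  half : ∀ {b : Bool} → length (map (b Vec.∷_) (cube n)) ≡ 2 ^ n
  half = trans (length-map _ (cube n)) (length-cube n)

-- Restrictions

Restriction : ℕ → Set
Restriction n = Vec (Maybe Bool) n

-- Stars are listed twice: a random restriction leaves each variable free with
-- probability 1/2 and fixes it to each value with probability 1/4.
restrictions : ∀ n → List (Restriction n)
restrictions zero    = [] ∷ []
restrictions (suc n) =
  map (just false ∷_) (restrictions n) ++ map (just true ∷_) (restrictions n) ++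
  map (nothing ∷_) (restrictions n) ++ map (nothing ∷_) (restrictions n)

#-restrictions : (p : Restriction (suc n) → Bool) →
  # p (restrictions (suc n)) ≡
    # (p ∘ (just false ∷_)) (restrictions n) + (# (p ∘ (just true ∷_)) (restrictions n) +
    (# (p ∘ (nothing ∷_)) (restrictions n) + # (p ∘ (nothing ∷_)) (restrictions n)))
#-restrictions {n} p =
  trans (#-++ p (map _ R) _) (cong₂ _+_ (#-map p _ R)
  (trans (#-++ p (map _ R) _) (cong₂ _+_ (#-map p _ R)
  (trans (#-++ p (map _ R) _) (cong₂ _+_ (#-map p _ R) (#-map p _ R))))))
  where R = restrictions n

length-restrictions : ∀ n → length (restrictions n) ≡ 4 ^ n
length-restrictions zero = refl
length-restrictions (suc n) =
  trans (length-++ (map _ R)) (cong₂ _+_ part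
  (trans (length-++ (map _ R)) (cong₂ _+_ part
  (trans (length-++ (map _ R)) (cong₂ _+_ part (trans part (sym (+-identityʳ _))))))))
  where
  R = restrictions n
  part : ∀ {m : Maybe Bool} → length (map (m Vec.∷_) R) ≡ 4 ^ n
  part = trans (length-map _ R) (length-restrictions n)

Agrees : Restriction n → Vec Bool n → Set
Agrees = Pointwise (λ m b → All (b ≡_) m)

-- Defined by recursion on the coordinates rather than by a search over completions, so that the
-- induction in `#≤#hits²` passes to the two halves of `A` by computation.
hits : (Vec Bool n → Bool) → Restriction n → Bool
hits A []            = A []
hits A (just b ∷ ρ)  = hits (A ∘ (b ∷_)) ρ
hits A (nothing ∷ ρ) = hits (A ∘ (false ∷_)) ρ ∨ hits (A ∘ (true ∷_)) ρ

hits⁻ : ∀ (A : Vec Bool n → Bool) ρ → T (hits A ρ) → ∃[ x ] T (A x) × Agrees ρ x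
hits⁻ A [] h = [] , h , []
hits⁻ A (just b ∷ ρ) h = let x , Ax , ag = hits⁻ _ ρ h in b ∷ x , Ax , just refl ∷ ag
hits⁻ A (nothing ∷ ρ) h with to T-∨ h
... | inj₁ h = let x , Ax , ag = hits⁻ _ ρ h in false ∷ x , Ax , nothing ∷ ag
... | inj₂ h = let x , Ax , ag = hits⁻ _ ρ h in true ∷ x , Ax , nothing ∷ ag

hits⁺ : ∀ (A : Vec Bool n → Bool) {ρ x} → T (A x) → Agrees ρ x → T (hits A ρ)
hits⁺ A Ax [] = Ax
hits⁺ A Ax (just refl ∷ ag) = hits⁺ _ Ax ag
hits⁺ A {x = false ∷ _} Ax (nothing ∷ ag) = from T-∨ (inj₁ (hits⁺ _ Ax ag))
hits⁺ A {x = true ∷ _} Ax (nothing ∷ ag) = from T-∨ (inj₂ (hits⁺ _ Ax ag))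

-- Comparing a set of points with the restrictions that hit it

^-distribʳ-* : ∀ k m n → (m * n) ^ k ≡ m ^ k * n ^ k
^-distribʳ-* zero m n = refl
^-distribʳ-* (suc k) m n = trans (cong (m * n *_) (^-distribʳ-* k m n)) (lem m n (m ^ k) (n ^ k))
  where
  lem : ∀ a b c d → a * b * (c * d) ≡ a * c * (b * d)
  lem = solve-∀

m²≤n²⇒m≤n : ∀ {m n} → m * m ≤ n * n → m ≤ n
m²≤n²⇒m≤n le = ≮⇒≥ λ n<m → ≤⇒≯ le (*-mono-< n<m n<m)

-- For u = v + d the difference (3u + v)² − 8(u² + v²) is 8vd + d².
8[u²+v²]≤[3u+v]² : ∀ {u v} → v ≤ u → 8 * (u * u + v * v) ≤ (3 * u + v) * (3 * u + v)
8[u²+v²]≤[3u+v]² {v = v} v≤u with m≤n⇒∃[o]m+o≡n v≤u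
... | d , refl = ≤-trans (m≤m+n _ (8 * v * d + d * d)) (≤-reflexive (lem v d))
  where
  lem : ∀ v d → 8 * ((v + d) * (v + d) + v * v) + (8 * v * d + d * d) ≡
                (3 * (v + d) + v) * (3 * (v + d) + v)
  lem = solve-∀

-- The arithmetic of one coordinate in `#≤#hits²`: `u`, `v` and `m` count the hits with the
-- coordinate false, true and free, the last with multiplicity 2. If `u` is the larger of `u` and
-- `v`, then u + v + 2m is at least 3u + v.
8[u²+v²]≤[u+v+2m]² : ∀ {u v m} → u ≤ m → v ≤ m →
  8 * (u * u + v * v) ≤ (u + (v + (m + m))) * (u + (v + (m + m)))
8[u²+v²]≤[u+v+2m]² {u} {v} {m} u≤m v≤m with ≤-total v u
... | inj₁ v≤u = ≤-trans (8[u²+v²]≤[3u+v]² v≤u) (*-mono-≤ le le)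
  where
  lem : ∀ u v → 3 * u + v ≡ u + (v + (u + u))
  lem = solve-∀
  le = ≤-trans (≤-reflexive (lem u v)) (+-monoʳ-≤ u (+-monoʳ-≤ v (+-mono-≤ u≤m u≤m)))
... | inj₂ u≤v = ≤-trans (≤-reflexive (cong (8 *_) (+-comm (u * u) (v * v))))
  (≤-trans (8[u²+v²]≤[3u+v]² u≤v) (*-mono-≤ le le))
  where
  lem : ∀ u v → 3 * v + u ≡ u + (v + (v + v))
  lem = solve-∀
  le = ≤-trans (≤-reflexive (lem u v)) (+-monoʳ-≤ u (+-monoʳ-≤ v (+-mono-≤ v≤m v≤m)))

-- In terms of probabilities: Pr[A] ≤ Pr[the restriction hits A]².
#≤#hits² : ∀ n (A : Vec Bool n → Bool) →
  8 ^ n * # A (cube n) ≤ # (hits A) (restrictions n) * # (hits A) (restrictions n)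
#≤#hits² zero A with A []
... | true  = ≤-refl
... | false = z≤n
#≤#hits² (suc n) A
  rewrite #-cube A | #-restrictions (hits A) = begin
  -- Each coordinate contributes 8 = 4² / 2: it multiplies the number of restrictions by 4, squared
  -- on the right, and the number of points by 2.
  8 * 8 ^ n * (a₀ + a₁)                ≡⟨ lem (8 ^ n) a₀ a₁ ⟩
  8 * (8 ^ n * a₀ + 8 ^ n * a₁)        ≤⟨ *-monoʳ-≤ 8 (+-mono-≤ (#≤#hits² n A₀) (#≤#hits² n A₁)) ⟩
  8 * (u * u + v * v)                  ≤⟨ 8[u²+v²]≤[u+v+2m]² u≤m v≤m ⟩
  (u + (v + (m + m))) * (u + (v + (m + m))) ∎
  where
  open ≤-Reasoning
  A₀ = A ∘ (false ∷_)
  A₁ = A ∘ (true ∷_)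
  a₀ = # A₀ (cube n)
  a₁ = # A₁ (cube n)
  u = # (hits A₀) (restrictions n)
  v = # (hits A₁) (restrictions n)
  m = # (λ ρ → hits A₀ ρ ∨ hits A₁ ρ) (restrictions n)
  u≤m : u ≤ m
  u≤m = #-mono (λ _ → from T-∨ ∘ inj₁) (restrictions n)
  v≤m : v ≤ m
  v≤m = #-mono (λ _ → from T-∨ ∘ inj₂) (restrictions n)
  lem : ∀ e a b → 8 * e * (a + b) ≡ 8 * (e * a + e * b)
  lem = solve-∀

-- Restrictions that force literals and terms

forcesLiteral : Restriction n → Literal n → Bool
-- The default `false`: a free variable forces neither of its literals.
forcesLiteral ρ (i , b) = maybe (λ a → if b then a else not a) false (lookup ρ i)

forcesTerm : Restriction n → Term n → Bool
forcesTerm ρ t = all (forcesLiteral ρ) t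

forces : DNF n → Restriction n → Bool
forces F ρ = any (forcesTerm ρ) F

module _ {ρ : Restriction n} {x : Vec Bool n} (ag : Agrees ρ x) where

  forcesLiteral⇒evalLiteral : ∀ l → T (forcesLiteral ρ l) → T (evalLiteral x l)
  forcesLiteral⇒evalLiteral (i , b) h with lookup ρ i | Pointwise.lookup ag i
  ... | just a | just refl = h

  forcesTerm⇒evalTerm : ∀ t → T (forcesTerm ρ t) → T (evalTerm x t)
  forcesTerm⇒evalTerm [] h = h
  forcesTerm⇒evalTerm (l ∷ t) h = let hl , ht = to T-∧ h in
    from T-∧ (forcesLiteral⇒evalLiteral l hl , forcesTerm⇒evalTerm t ht)

  -- Used in the contrapositive: a restriction with a completion that falsifies `F` forces no term
  -- of `F`.
  forces⇒eval : ∀ F → T (forces F ρ) → T (eval F x)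
  forces⇒eval (t ∷ F) h with to T-∨ h
  ... | inj₁ ht = from T-∨ (inj₁ (forcesTerm⇒evalTerm t ht))
  ... | inj₂ hF = from T-∨ (inj₂ (forces⇒eval F hF))

evalLiteral⇒lookup : ∀ (x : Vec Bool n) i b → T (evalLiteral x (i , b)) → lookup x i ≡ b
evalLiteral⇒lookup x i b h with lookup x i | b
... | true  | true  = refl
... | false | false = refl

Agrees-update : ∀ {ρ : Restriction n} {x} i → Agrees ρ x → Agrees (ρ [ i ]≔ just (lookup x i)) x
Agrees-update zero (_ ∷ ag) = just refl ∷ ag
Agrees-update (suc i) (h ∷ ag) = h ∷ Agrees-update i ag

-- A literal of the updated variable stays forced because the new value is taken from a completion
-- of `ρ`, where every forced literal is already true.
forcesTerm-update : ∀ {ρ : Restriction n} {x} i → Agrees ρ x → ∀ t →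
  T (forcesTerm ρ t) → T (forcesTerm (ρ [ i ]≔ just (lookup x i)) t)
forcesTerm-update i ag [] h = h
forcesTerm-update {ρ = ρ} {x} i ag ((j , b) ∷ t) h =
  from T-∧ (literal , forcesTerm-update i ag t (proj₂ (to T-∧ h)))
  where
  literal : T (forcesLiteral (ρ [ i ]≔ just (lookup x i)) (j , b))
  literal with j Fin.≟ i
  ... | yes refl rewrite lookup∘updateAt i {λ _ → just (lookup x i)} ρ =
    forcesLiteral⇒evalLiteral ag (i , b) (proj₁ (to T-∧ h))
  ... | no j≢i rewrite lookup∘updateAt′ j i {λ _ → just (lookup x i)} j≢i ρ = proj₁ (to T-∧ h)

-- The restrictions counted on the right give xᵢ the value b, with multiplicity
-- 1; those counted on the left give it the value b or a star, with multiplicity 3.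
#≤3#forced : ∀ (i : Fin n) b (q : Restriction n → Bool) →
  (∀ ρ → T (q ρ) → T (q (ρ [ i ]≔ just b))) →
  (∀ ρ → lookup ρ i ≡ just (not b) → ¬ T (q ρ)) →
  # q (restrictions n) ≤ 3 * # (λ ρ → forcesLiteral ρ (i , b) ∧ q ρ) (restrictions n)
#≤3#forced {suc n} zero false q up no-b
  rewrite #-restrictions q
        | #-restrictions (λ ρ → forcesLiteral ρ (zero , false) ∧ q ρ) = begin
  f + (t + (s + s)) ≤⟨ +-monoʳ-≤ f (+-mono-≤ t≤0 (+-mono-≤ s≤f s≤f)) ⟩
  f + (0 + (f + f)) ≡⟨ lem f ⟩
  3 * f             ≤⟨ *-monoʳ-≤ 3 (m≤m+n f _) ⟩
  3 * (f + _)       ∎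
  where
  open ≤-Reasoning
  f = # (q ∘ (just false ∷_)) (restrictions n)
  t = # (q ∘ (just true ∷_)) (restrictions n)
  s = # (q ∘ (nothing ∷_)) (restrictions n)
  t≤0 : t ≤ 0
  t≤0 = ≤-trans (#-mono (λ ρ h → no-b (just true ∷ ρ) refl h) (restrictions n))
    (≤-reflexive (#-false (restrictions n)))
  s≤f : s ≤ f
  s≤f = #-mono (λ ρ h → up (nothing ∷ ρ) h) (restrictions n)
  lem : ∀ f → f + (0 + (f + f)) ≡ 3 * f
  lem = solve-∀
#≤3#forced {suc n} zero true q up no-b
  rewrite #-restrictions q
        | #-restrictions (λ ρ → forcesLiteral ρ (zero , true) ∧ q ρ) = begin
  f + (t + (s + s)) ≤⟨ +-mono-≤ f≤0 (+-monoʳ-≤ t (+-mono-≤ s≤t s≤t)) ⟩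
  0 + (t + (t + t)) ≡⟨ lem t ⟩
  3 * t             ≤⟨ *-monoʳ-≤ 3 (≤-trans (m≤m+n t (z + z)) (m≤n+m (t + (z + z)) z)) ⟩
  3 * (z + (t + (z + z))) ∎
  where
  open ≤-Reasoning
  f = # (q ∘ (just false ∷_)) (restrictions n)
  t = # (q ∘ (just true ∷_)) (restrictions n)
  s = # (q ∘ (nothing ∷_)) (restrictions n)
  z = # (λ _ → false) (restrictions n)
  f≤0 : f ≤ 0
  f≤0 = ≤-trans (#-mono (λ ρ h → no-b (just false ∷ ρ) refl h) (restrictions n))
    (≤-reflexive (#-false (restrictions n)))
  s≤t : s ≤ t
  s≤t = #-mono (λ ρ h → up (nothing ∷ ρ) h) (restrictions n)
  lem : ∀ f → 0 + (f + (f + f)) ≡ 3 * f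
  lem = solve-∀
#≤3#forced {suc n} (suc i) b q up no-b
  rewrite #-restrictions q
        | #-restrictions (λ ρ → forcesLiteral ρ (suc i , b) ∧ q ρ) =
  ≤-trans (+-mono-≤ (ih (just false)) (+-mono-≤ (ih (just true)) (+-mono-≤ (ih nothing) (ih nothing))))
    (≤-reflexive (lem (N (just false)) (N (just true)) (N nothing)))
  where
  N : Maybe Bool → ℕ
  N m = # (λ ρ → forcesLiteral ρ (i , b) ∧ q (m ∷ ρ)) (restrictions n)
  ih : ∀ m → # (q ∘ (m ∷_)) (restrictions n) ≤
             3 * N m
  ih m = #≤3#forced i b (q ∘ (m ∷_)) (λ ρ → up (m ∷ ρ)) (λ ρ → no-b (m ∷ ρ))
  lem : ∀ a b c → 3 * a + (3 * b + (3 * c + 3 * c)) ≡ 3 * (a + (b + (c + c)))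
  lem = solve-∀

-- The literals of `t` are forced one at a time, each at the cost of a factor 3. Every completion in
-- `A` satisfies `t`, so setting a variable as `t` demands keeps that completion, and no restriction
-- hitting `A` has the opposite value there.
#hits≤#forced : ∀ (t : Term n) (A : Vec Bool n → Bool) → (∀ x → T (A x) → T (evalTerm x t)) →
  # (hits A) (restrictions n) ≤
    3 ^ length t * # (λ ρ → forcesTerm ρ t ∧ hits A ρ) (restrictions n)
#hits≤#forced [] A A⊆t = ≤-reflexive (sym (*-identityˡ _))
#hits≤#forced {n} ((i , b) ∷ t) A A⊆t = begin
  # (hits A) R
    ≤⟨ #hits≤#forced t A (λ x Ax → proj₂ (to T-∧ (A⊆t x Ax))) ⟩
  3 ^ length t * # q R
    ≤⟨ *-monoʳ-≤ (3 ^ length t) (#≤3#forced i b q up no-b) ⟩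
  3 ^ length t * (3 * # (λ ρ → forcesLiteral ρ (i , b) ∧ q ρ) R)
    ≡⟨ lem (3 ^ length t) _ ⟩
  3 * 3 ^ length t * # (λ ρ → forcesLiteral ρ (i , b) ∧ q ρ) R
    ≤⟨ *-monoʳ-≤ (3 * 3 ^ length t) (#-mono assoc R) ⟩
  3 * 3 ^ length t * # (λ ρ → forcesTerm ρ ((i , b) ∷ t) ∧ hits A ρ) R ∎
  where
  open ≤-Reasoning
  R = restrictions n
  q : Restriction n → Bool
  q ρ = forcesTerm ρ t ∧ hits A ρ
  lookup≡b : ∀ x → T (A x) → lookup x i ≡ b
  lookup≡b x Ax = evalLiteral⇒lookup x i b (proj₁ (to T-∧ (A⊆t x Ax)))
  up : ∀ ρ → T (q ρ) → T (q (ρ [ i ]≔ just b))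
  up ρ h with to T-∧ h
  ... | ht , hA with hits⁻ A ρ hA
  ... | x , Ax , ag with lookup≡b x Ax
  ... | refl = from T-∧ (forcesTerm-update i ag t ht , hits⁺ A Ax (Agrees-update i ag))
  no-b : ∀ ρ → lookup ρ i ≡ just (not b) → ¬ T (q ρ)
  no-b ρ eq h with hits⁻ A ρ (proj₂ (to T-∧ h))
  ... | x , Ax , ag with lookup ρ i | Pointwise.lookup ag i | lookup≡b x Ax
  no-b ρ refl h | x , Ax , ag | _ | just xi≡ | eq =
    not-¬ refl (trans (sym eq) xi≡)
  lem : ∀ p m → p * (3 * m) ≡ 3 * p * m
  lem = solve-∀
  assoc : ∀ ρ → T (forcesLiteral ρ (i , b) ∧ q ρ) →
          T (forcesTerm ρ ((i , b) ∷ t) ∧ hits A ρ)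
  assoc ρ h =
    let hl , hq = to (T-∧ {forcesLiteral ρ (i , b)}) h
        ht , hA = to (T-∧ {forcesTerm ρ t}) hq
    in from T-∧ (from T-∧ (hl , ht) , hA)

-- Sparsification

first : DNF n → Term n → Vec Bool n → Bool
first E t x = evalTerm x t ∧ not (eval E x)

-- E lists the terms preceding F, the most recent first; the threshold δ is 1/s².
sparsify : ℕ → DNF n → DNF n → DNF n
sparsify s E [] = []
sparsify {n} s E (t ∷ F) with 2 ^ n ≤? s * s * # (first E t) (cube n)
... | yes _ = t ∷ sparsify s (t ∷ E) F
... | no _  = sparsify s (t ∷ E) F

width-sparsify : ∀ s (E F : DNF n) → width (sparsify s E F) ≤ width F
width-sparsify s E [] = z≤n
width-sparsify {n} s E (t ∷ F) with 2 ^ n ≤? s * s * # (first E t) (cube n)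
... | yes _ = ⊔-monoʳ-≤ (length t) (width-sparsify s (t ∷ E) F)
... | no _  = ≤-trans (width-sparsify s (t ∷ E) F) (m≤n⊔m (length t) _)

eval-sparsify : ∀ s (E F : DNF n) x → T (eval (sparsify s E F) x) → T (eval F x)
eval-sparsify {n} s E (t ∷ F) x h with 2 ^ n ≤? s * s * # (first E t) (cube n)
... | no _  = from T-∨ (inj₂ (eval-sparsify s (t ∷ E) F x h))
... | yes _ with to T-∨ h
...   | inj₁ ht = from T-∨ (inj₁ ht)
...   | inj₂ hF = from T-∨ (inj₂ (eval-sparsify s (t ∷ E) F x hF))

-- A kept term is the first one satisfied at no fewer than 2ⁿ / s² points, none of which satisfies
-- `E`. The summand with `eval E` records the points already claimed by preceding terms, which
-- carries the induction; at `E = []` it is dropped and s² bounds the number of kept terms.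
length-sparsify : ∀ s (E F : DNF n) →
  length (sparsify s E F) * 2 ^ n + s * s * # (eval E) (cube n) ≤ s * s * 2 ^ n
length-sparsify {n} s E [] =
  *-monoʳ-≤ (s * s) (≤-trans (#-≤length (eval E) (cube n)) (≤-reflexive (length-cube n)))
length-sparsify {n} s E (t ∷ F) with 2 ^ n ≤? s * s * # (first E t) (cube n)
... | no _ = ≤-trans (+-monoʳ-≤ (length (sparsify s (t ∷ E) F) * 2 ^ n)
    (*-monoʳ-≤ (s * s) (#-mono (λ _ → from T-∨ ∘ inj₂) (cube n))))
  (length-sparsify s (t ∷ E) F)
... | yes large = begin
  (2 ^ n + g * 2 ^ n) + s * s * e   ≤⟨ +-monoˡ-≤ (s * s * e) (+-monoˡ-≤ (g * 2 ^ n) large) ⟩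
  (s * s * a + g * 2 ^ n) + s * s * e ≡⟨ lem (s * s) a (g * 2 ^ n) e ⟩
  g * 2 ^ n + s * s * (a + e)       ≤⟨ +-monoʳ-≤ (g * 2 ^ n) (*-monoʳ-≤ (s * s) a+e≤) ⟩
  g * 2 ^ n + s * s * # (eval (t ∷ E)) (cube n) ≤⟨ length-sparsify s (t ∷ E) F ⟩
  s * s * 2 ^ n ∎
  where
  open ≤-Reasoning
  g = length (sparsify s (t ∷ E) F)
  a = # (first E t) (cube n)
  e = # (eval E) (cube n)
  lem : ∀ d a g e → (d * a + g) + d * e ≡ g + d * (a + e)
  lem = solve-∀
  a+e≤ : a + e ≤ # (eval (t ∷ E)) (cube n)
  a+e≤ = #-disjoint (λ x h → T-not⁻ (proj₂ (to (T-∧ {evalTerm x t}) h)))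
    (λ x h → from T-∨ (inj₁ (proj₁ (to (T-∧ {evalTerm x t}) h)))) (λ x → from T-∨ ∘ inj₂) (cube n)

-- The factor `not (eval E x)` leaves out the points already settled by a preceding term, so that
-- each error is charged to the first term satisfied there.
missed : DNF n → DNF n → DNF n → Vec Bool n → Bool
missed E F G x = not (eval E x) ∧ (eval F x ∧ not (eval G x))

-- Divided by 4ⁿ, this reads s · Pr[missed] + 3ʷ · Pr[ρ forces E] ≤ 3ʷ. A dropped term is charged to
-- the restrictions that force it and have a completion where it is the first satisfied. These sets
-- are disjoint for distinct terms, and the second summand reserves room for the preceding ones.
#missed : ∀ s (E F : DNF n) w → width F ≤ w →
  2 ^ n * (s * # (missed E F (sparsify s E F)) (cube n)) +
    3 ^ w * # (forces E) (restrictions n) ≤ 3 ^ w * 4 ^ n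
#missed {n} s E [] w _ = ≤-trans (≤-reflexive (cong (_+ 3 ^ w * # (forces E) (restrictions n)) zeros))
  (*-monoʳ-≤ (3 ^ w) (≤-trans (#-≤length (forces E) (restrictions n))
    (≤-reflexive (length-restrictions n))))
  where
  #≤0 : # (missed E [] []) (cube n) ≤ 0
  #≤0 = ≤-trans (#-mono (λ x h → proj₂ (to (T-∧ {not (eval E x)}) h)) (cube n))
    (≤-reflexive (#-false (cube n)))
  zeros : 2 ^ n * (s * # (missed E [] []) (cube n)) ≡ 0
  zeros rewrite n≤0⇒n≡0 #≤0 | *-zeroʳ s = *-zeroʳ (2 ^ n)
#missed {n} s E (t ∷ F) w width≤w with 2 ^ n ≤? s * s * # (first E t) (cube n)
-- A kept term adds no error: the output is true wherever `t` is, so a missed point falsifies `t`.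
... | yes _ = ≤-trans (+-mono-≤ (*-monoʳ-≤ (2 ^ n) (*-monoʳ-≤ s (#-mono sub (cube n))))
    (*-monoʳ-≤ (3 ^ w) (#-mono (λ _ → from T-∨ ∘ inj₂) (restrictions n))))
  (#missed s (t ∷ E) F w (≤-trans (m≤n⊔m (length t) _) width≤w))
  where
  sub : ∀ x → T (missed E (t ∷ F) (t ∷ sparsify s (t ∷ E) F) x) →
        T (missed (t ∷ E) F (sparsify s (t ∷ E) F) x)
  sub x h with evalTerm x t | eval E x | eval F x
  ... | false | false | true = h
... | no small = begin
  2 ^ n * (s * # (missed E (t ∷ F) G) (cube n)) + 3 ^ w * e
    ≤⟨ +-monoˡ-≤ (3 ^ w * e) (*-monoʳ-≤ (2 ^ n) (*-monoʳ-≤ s (#-∪ split (cube n)))) ⟩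
  2 ^ n * (s * (a + m)) + 3 ^ w * e
    ≡⟨ lem₁ (2 ^ n) s a m (3 ^ w * e) ⟩
  2 ^ n * (s * a) + (2 ^ n * (s * m) + 3 ^ w * e)
    ≤⟨ +-monoˡ-≤ _ (≤-trans 2ⁿsa≤N N≤) ⟩
  3 ^ w * k + (2 ^ n * (s * m) + 3 ^ w * e)
    ≡⟨ lem₂ (3 ^ w) k (2 ^ n * (s * m)) e ⟩
  2 ^ n * (s * m) + 3 ^ w * (k + e)
    ≤⟨ +-monoʳ-≤ (2 ^ n * (s * m)) (*-monoʳ-≤ (3 ^ w) k+e≤) ⟩
  2 ^ n * (s * m) + 3 ^ w * # (forces (t ∷ E)) (restrictions n)
    ≤⟨ #missed s (t ∷ E) F w (≤-trans (m≤n⊔m (length t) _) width≤w) ⟩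
  3 ^ w * 4 ^ n ∎
  where
  open ≤-Reasoning
  G = sparsify s (t ∷ E) F
  A = first E t
  a = # A (cube n)
  m = # (missed (t ∷ E) F G) (cube n)
  e = # (forces E) (restrictions n)
  N = # (hits A) (restrictions n)
  k = # (λ ρ → forcesTerm ρ t ∧ hits A ρ) (restrictions n)
  lem₁ : ∀ p s a m r → p * (s * (a + m)) + r ≡ p * (s * a) + (p * (s * m) + r)
  lem₁ = solve-∀
  lem₂ : ∀ p k r e → p * k + (r + p * e) ≡ r + p * (k + e)
  lem₂ = solve-∀
  lem₃ : ∀ p s a → p * (s * a) * (p * (s * a)) ≡ p * p * (s * s * a) * a
  lem₃ = solve-∀
  split : ∀ x → T (missed E (t ∷ F) G x) → T (A x) ⊎ T (missed (t ∷ E) F G x)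
  split x h with evalTerm x t | eval E x
  ... | true  | false = inj₁ _
  ... | false | false = inj₂ h
  2ⁿ2ⁿ2ⁿ≡8ⁿ : 2 ^ n * 2 ^ n * 2 ^ n ≡ 8 ^ n
  2ⁿ2ⁿ2ⁿ≡8ⁿ = sym (trans (^-distribʳ-* n 4 2) (cong (_* 2 ^ n) (^-distribʳ-* n 2 2)))
  -- This is p ≤ √δ P for p = a / 2ⁿ, P = N / 4ⁿ and √δ = 1 / s: as the term was dropped, p² ≤ δ p ≤
  -- δ P².
  2ⁿsa≤N : 2 ^ n * (s * a) ≤ N
  2ⁿsa≤N = m²≤n²⇒m≤n (begin
    2 ^ n * (s * a) * (2 ^ n * (s * a)) ≡⟨ lem₃ (2 ^ n) s a ⟩
    2 ^ n * 2 ^ n * (s * s * a) * a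
      ≤⟨ *-monoˡ-≤ a (*-monoʳ-≤ (2 ^ n * 2 ^ n) (<⇒≤ (≰⇒> small))) ⟩
    2 ^ n * 2 ^ n * 2 ^ n * a           ≡⟨ cong (_* a) 2ⁿ2ⁿ2ⁿ≡8ⁿ ⟩
    8 ^ n * a                           ≤⟨ #≤#hits² n A ⟩
    N * N                               ∎)
  N≤ : N ≤ 3 ^ w * k
  N≤ = ≤-trans (#hits≤#forced t A (λ x → proj₁ ∘ to T-∧))
    (*-monoˡ-≤ k (^-monoʳ-≤ 3 (≤-trans (m≤m⊔n (length t) _) width≤w)))
  -- A restriction forcing t and hitting A forces no earlier term.
  k+e≤ : k + e ≤ # (forces (t ∷ E)) (restrictions n)
  k+e≤ = #-disjoint disjoint
    (λ ρ h → from T-∨ (inj₁ (proj₁ (to (T-∧ {forcesTerm ρ t}) h))))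
    (λ ρ → from T-∨ ∘ inj₂) (restrictions n)
    where
    disjoint : ∀ ρ → T (forcesTerm ρ t ∧ hits A ρ) → ¬ T (forces E ρ)
    disjoint ρ h hE with hits⁻ A ρ (proj₂ (to (T-∧ {forcesTerm ρ t}) h))
    ... | x , Ax , ag = T-not⁻ (proj₂ (to (T-∧ {evalTerm x t}) Ax)) (forces⇒eval ag E hE)

sparsification : ∀ w e (f : Vec Bool n → Bool) (F : DNF n) → F computes f → width F ≤ w →
  Σ[ G ∈ DNF n ] width G ≤ w ×
    length G ≤ (3 ^ w * 2 ^ e) * (3 ^ w * 2 ^ e) ×
    2 ^ e * length (filter (λ x → ¬? (f x ≟ eval G x)) (cube n)) ≤ 2 ^ n
sparsification {n} w e f F F≈f width≤w =
  G , ≤-trans (width-sparsify s [] F) width≤w , length≤ , errors≤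
  where
  open ≤-Reasoning
  -- With this choice the error bound 3ʷ / s from `#missed` is 2⁻ᵉ.
  s = 3 ^ w * 2 ^ e
  G = sparsify s [] F
  instance
    _ = m^n≢0 2 n
    _ = m^n≢0 3 w
  length≤ : length G ≤ s * s
  length≤ = *-cancelʳ-≤ (length G) (s * s) (2 ^ n)
    (≤-trans (m≤m+n _ _) (length-sparsify s [] F))
  m = # (missed [] F G) (cube n)
  lem : ∀ x y z m → x * y * (z * m) ≡ x * (y * z * m)
  lem = solve-∀
  lem′ : ∀ x y → y * (x * x) ≡ x * y * x
  lem′ = solve-∀
  2ᵉm≤2ⁿ : 2 ^ e * m ≤ 2 ^ n
  2ᵉm≤2ⁿ = *-cancelˡ-≤ (2 ^ n * 3 ^ w) {{m*n≢0 (2 ^ n) (3 ^ w)}} (begin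
    2 ^ n * 3 ^ w * (2 ^ e * m) ≡⟨ lem (2 ^ n) (3 ^ w) (2 ^ e) m ⟩
    2 ^ n * (s * m)             ≤⟨ m≤m+n _ _ ⟩
    2 ^ n * (s * m) + _         ≤⟨ #missed s [] F w width≤w ⟩
    3 ^ w * 4 ^ n               ≡⟨ cong (3 ^ w *_) (^-distribʳ-* n 2 2) ⟩
    3 ^ w * (2 ^ n * 2 ^ n)     ≡⟨ lem′ (2 ^ n) (3 ^ w) ⟩
    2 ^ n * 3 ^ w * 2 ^ n       ∎)
  -- Errors are one-sided: `G` consists of terms of `F`, so `G` true with `F` false is impossible.
  errors⊆missed : ∀ x → ¬ f x ≡ eval G x → T (missed [] F G x)
  errors⊆missed x ne rewrite sym (F≈f x) with eval F x | eval G x | eval-sparsify s [] F x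
  ... | true  | true  | _ = contradiction refl ne
  ... | true  | false | _ = _
  ... | false | true  | c = c _
  ... | false | false | _ = contradiction refl ne
  errors≤ : 2 ^ e * length (filter (λ x → ¬? (f x ≟ eval G x)) (cube n)) ≤ 2 ^ n
  errors≤ = ≤-trans (*-monoʳ-≤ (2 ^ e) (length-filter≤# _ errors⊆missed (cube n))) 2ᵉm≤2ⁿ

-- Positive reals

fromℕ-cancel-≤ : ∀ {j k} → fromℕ j ℚ.≤ fromℕ k → j ≤ k
fromℕ-cancel-≤ {j} {k} (*≤* le) =
  ℤ.drop‿+≤+ (subst₂ ℤ._≤_ (ℤ.*-identityʳ (+ j)) (ℤ.*-identityʳ (+ k)) le)

fromℕ-* : ∀ j k → fromℕ j ℚ.* fromℕ k ≡ fromℕ (j * k)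
fromℕ-* j k = cong (λ z → mkℚᵘ z 0) (sym (ℤ.pos-* j k))

fromℕ-^ : ∀ j k → fromℕ j ^ℚ k ≡ fromℕ (j ^ k)
fromℕ-^ j zero    = refl
fromℕ-^ j (suc k) rewrite fromℕ-^ j k = fromℕ-* j (j ^ k)

fromℕ-pos : ∀ k .{{_ : NonZero k}} → Positive (fromℕ k)
fromℕ-pos (suc k) = _

fromℕ≤⇒*≤∣↥∣ : ∀ {k} t → fromℕ k ℚ.≤ t → k * ↧ₙ t ≤ ℤ.∣ ↥ t ∣
fromℕ≤⇒*≤∣↥∣ {k} (mkℚᵘ (+ p) d) (*≤* le) = ℤ.drop‿+≤+
  (subst₂ ℤ._≤_ (sym (ℤ.pos-* k (suc d))) (ℤ.*-identityʳ (+ p)) le)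
fromℕ≤⇒*≤∣↥∣ {k} (mkℚᵘ (-[1+ p ]) d) (*≤* le)
  with () ← subst₂ ℤ._≤_ (sym (ℤ.pos-* k (suc d))) (ℤ.*-identityʳ -[1+ p ]) le

*≤∣↥∣⇒fromℕ≤ : ∀ {k} t → Positive t → k * ↧ₙ t ≤ ℤ.∣ ↥ t ∣ → fromℕ k ℚ.≤ t
*≤∣↥∣⇒fromℕ≤ {k} (mkℚᵘ (+ p) d) _ le = *≤*
  (subst₂ ℤ._≤_ (ℤ.pos-* k (suc d)) (sym (ℤ.*-identityʳ (+ p))) (ℤ.+≤+ le))

≤fromℕ∣↥∣ : ∀ t → t ℚ.≤ fromℕ ℤ.∣ ↥ t ∣
≤fromℕ∣↥∣ (mkℚᵘ (+ p) d) = *≤*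
  (subst₂ ℤ._≤_ (sym (ℤ.*-identityʳ (+ p))) (ℤ.pos-* p (suc d)) (ℤ.+≤+ (m≤m*n p (suc d))))
≤fromℕ∣↥∣ (mkℚᵘ -[1+ p ] d) = *≤*
  (subst₂ ℤ._≤_ (sym (ℤ.*-identityʳ -[1+ p ])) (ℤ.pos-* (suc p) (suc d)) ℤ.-≤+)

^ℚ-pos : ∀ {q} → Positive q → ∀ k → Positive (q ^ℚ k)
^ℚ-pos q>0 zero        = _
^ℚ-pos {q} q>0 (suc k) = ℚ.pos*pos⇒pos q {{q>0}} (q ^ℚ k) {{^ℚ-pos q>0 k}}

^ℚ-monoˡ-≤ : ∀ {q r} → Positive q → q ℚ.≤ r → ∀ k → q ^ℚ k ℚ.≤ r ^ℚ k
^ℚ-monoˡ-≤ q>0 q≤r zero    = ℚ.≤-refl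
^ℚ-monoˡ-≤ q>0 q≤r (suc k) = *-mono q>0 (^ℚ-pos q>0 k) q≤r (^ℚ-monoˡ-≤ q>0 q≤r k)

^ℚ-monoˡ-< : ∀ {q r} → Positive q → q ℚ.< r → ∀ k → q ^ℚ suc k ℚ.< r ^ℚ suc k
^ℚ-monoˡ-< q>0 q<r zero = ℚ.*-monoˡ-<-pos 1ℚᵘ q<r
^ℚ-monoˡ-< {q} q>0 q<r (suc k) = ℚ.*-mono-<-nonNeg
  {{ℚ.pos⇒nonNeg q {{q>0}}}} {{ℚ.pos⇒nonNeg (q ^ℚ suc k) {{^ℚ-pos {q} q>0 (suc k)}}}}
  q<r (^ℚ-monoˡ-< q>0 q<r k)

^ℚ-cancelˡ-≤ : ∀ {q r} → Positive r → ∀ k → q ^ℚ suc k ℚ.≤ r ^ℚ suc k → q ℚ.≤ r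
^ℚ-cancelˡ-≤ {r = r} r>0 k le = ℚ.≮⇒≥ λ r<q →
  ℚ.<-irrefl (ℚ.≃-refl {r ^ℚ suc k}) (ℚ.<-≤-trans (^ℚ-monoˡ-< r>0 r<q k) le)

^-cancelʳ-≤ : ∀ m → 1 < m → ∀ {j k} → m ^ j ≤ m ^ k → j ≤ k
^-cancelʳ-≤ m 1<m le = ≮⇒≥ λ k<j → ≤⇒≯ le (^-monoʳ-< m 1<m k<j)

floor-log₂ : ∀ n → 1 ≤ n → ∃[ k ] 2 ^ k ≤ n × n < 2 ^ suc k
floor-log₂ (suc zero) _ = 0 , ≤-refl , ≤-refl
floor-log₂ (suc n@(suc _)) _ with floor-log₂ n (s≤s z≤n)
... | k , 2^k≤n , n<2^1+k with suc n ℕ.<? 2 ^ suc k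
...   | yes lt = k , m≤n⇒m≤1+n 2^k≤n , lt
-- Here n + 1 equals 2 ^ suc k, so the exponent goes up by one.
...   | no ≮ = suc k , ≮⇒≥ ≮ , <-≤-trans (s≤s n<2^1+k)
  (≤-trans (+-monoˡ-≤ (2 ^ suc k) (m^n>0 2 (suc k))) (+-monoʳ-≤ (2 ^ suc k) (m≤m+n _ 0)))

-- Natural bounds for logarithms, powers, products and inverses of positive reals

module _ {n : ℕ} .{{_ : NonZero n}} where

  -- For t = p / d above the logarithm and its witness u ≥ n, the chain 2^(kd) ≤ n^d ≤ u^d ≤ 2^p
  -- gives kd ≤ p.
  ≤log : ∀ {k} → 2 ^ k ≤ n → fromℕ k ≤ℝ log (fromℕ⁺ n)
  ≤log {k} 2^k≤n {t} (2≤t , u , n≤u , u^≤) =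
    *≤∣↥∣⇒fromℕ≤ t t>0 (^-cancelʳ-≤ 2 ≤-refl (fromℕ-cancel-≤ (begin
      fromℕ (2 ^ (k * ↧ₙ t))   ≡⟨ cong fromℕ (^-*-assoc 2 k (↧ₙ t)) ⟨
      fromℕ ((2 ^ k) ^ ↧ₙ t)   ≤⟨ fromℕ-mono (^-monoˡ-≤ (↧ₙ t) 2^k≤n) ⟩
      fromℕ (n ^ ↧ₙ t)         ≡⟨ fromℕ-^ n (↧ₙ t) ⟨
      fromℕ n ^ℚ ↧ₙ t          ≤⟨ ^ℚ-monoˡ-≤ (fromℕ-pos n) n≤u (↧ₙ t) ⟩
      u ^ℚ ↧ₙ t                ≤⟨ u^≤ ⟩
      fromℕ 2 ^ℚ ℤ.∣ ↥ t ∣     ≡⟨ fromℕ-^ 2 ℤ.∣ ↥ t ∣ ⟩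
      fromℕ (2 ^ ℤ.∣ ↥ t ∣)    ∎)))
    where
    open ℚ.≤-Reasoning
    t>0 : Positive t
    t>0 = ℚ.positive (ℚ.<-≤-trans (ℚ.positive⁻¹ (fromℕ 2)) 2≤t)

  -- An upper bound on a positive real is given by a member of its set; `2 ≤ k` reflects the
  -- convention log ≥ 2.
  log≤ : ∀ {k} → 2 ≤ k → n ≤ 2 ^ k → Above (log (fromℕ⁺ n)) (fromℕ k)
  log≤ {k} 2≤k n≤2^k = fromℕ-mono 2≤k , fromℕ n , ℚ.≤-refl , (begin
    fromℕ n ^ℚ 1    ≡⟨ fromℕ-^ n 1 ⟩
    fromℕ (n ^ 1)   ≡⟨ cong fromℕ (^-identityʳ n) ⟩
    fromℕ n         ≤⟨ fromℕ-mono n≤2^k ⟩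
    fromℕ (2 ^ k)   ≡⟨ fromℕ-^ 2 k ⟨
    fromℕ 2 ^ℚ k    ∎)
    where open ℚ.≤-Reasoning

  ^≤^ℝ : ∀ {k x} → fromℕ k ≤ℝ x → fromℕ (n ^ k) ≤ℝ n ^ℝ x
  ^≤^ℝ {k} k≤x {t} (t>0 , r , r∈x , n^≤t^) = ^ℚ-cancelˡ-≤ t>0 (ℚᵘ.denominator-1 r) (begin
    fromℕ (n ^ k) ^ℚ ↧ₙ r    ≡⟨ fromℕ-^ (n ^ k) (↧ₙ r) ⟩
    fromℕ ((n ^ k) ^ ↧ₙ r)   ≡⟨ cong fromℕ (^-*-assoc n k (↧ₙ r)) ⟩
    fromℕ (n ^ (k * ↧ₙ r))   ≤⟨ fromℕ-mono (^-monoʳ-≤ n (fromℕ≤⇒*≤∣↥∣ r (k≤x r∈x))) ⟩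
    fromℕ (n ^ ℤ.∣ ↥ r ∣)    ≡⟨ fromℕ-^ n ℤ.∣ ↥ r ∣ ⟨
    fromℕ n ^ℚ ℤ.∣ ↥ r ∣     ≤⟨ n^≤t^ ⟩
    t ^ℚ ↧ₙ r                ∎)
    where open ℚ.≤-Reasoning

  -- The exponent is rounded up to its numerator, which avoids a possibly irrational root; the loss
  -- is absorbed by the constant of the theorem.
  ^ℝ≤^ : ∀ {x r} → Above x r → Above (n ^ℝ x) (fromℕ (n ^ ℤ.∣ ↥ r ∣))
  ^ℝ≤^ {x} {r} r∈x = fromℕ-pos (n ^ p) {{m^n≢0 n p}} , r , r∈x , (begin
    fromℕ n ^ℚ p             ≡⟨ fromℕ-^ n p ⟩
    fromℕ (n ^ p)
      ≤⟨ fromℕ-mono (m≤m*n (n ^ p) ((n ^ p) ^ d) {{m^n≢0 _ d {{m^n≢0 n p}}}}) ⟩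
    fromℕ ((n ^ p) ^ ↧ₙ r)   ≡⟨ fromℕ-^ (n ^ p) (↧ₙ r) ⟨
    fromℕ (n ^ p) ^ℚ ↧ₙ r    ∎)
    where
    open ℚ.≤-Reasoning
    p = ℤ.∣ ↥ r ∣
    d = ℚᵘ.denominator-1 r

*≤*ℝ : ∀ {j k x y} .{{_ : NonZero j}} .{{_ : NonZero k}} →
  fromℕ j ≤ℝ x → fromℕ k ≤ℝ y → fromℕ (j * k) ≤ℝ x *ℝ y
*≤*ℝ {j} {k} j≤x k≤y (r , s , r∈x , s∈y , rs≤t) = ℚ.≤-trans
  (ℚ.≤-reflexive-≡ (sym (fromℕ-* j k)))
  (ℚ.≤-trans (*-mono (fromℕ-pos j) (fromℕ-pos k) (j≤x r∈x) (k≤y s∈y)) rs≤t)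

*ℝ≤* : ∀ {x y r} k .{{_ : NonZero k}} → Above x r → Above y (fromℕ k) →
  Above (x *ℝ y) (fromℕ (ℤ.∣ ↥ r ∣ * k))
*ℝ≤* {x = x} {r = r} k r∈x k∈y = r , fromℕ k , r∈x , k∈y , ℚ.≤-trans
  (*-mono (Above⇒pos x r∈x) (fromℕ-pos k) (≤fromℕ∣↥∣ r) ℚ.≤-refl)
  (ℚ.≤-reflexive-≡ (fromℕ-* ℤ.∣ ↥ r ∣ k))

-- Let q be the fraction on the left. For positive p ≤ x ≤ k with 1 ≤ tp, one has qp ≤ qk ≤ 1 ≤ tp,
-- and p cancels.
/≤⁻¹ : ∀ {x k} m d .{{_ : NonZero d}} → Above x (fromℕ k) → k * m ≤ d → (+ m ℚ./ d) ≤ℝ x ⁻¹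
/≤⁻¹ {k = k} m (suc d) k∈x km≤d {t} (p , p>0 , p≤x , 1≤tp) =
  ℚ.*-cancelʳ-≤-pos p {{p>0}} (begin
    q ℚ.* p         ≤⟨ ℚ.*-monoʳ-≤-nonNeg q (p≤x k∈x) ⟩
    q ℚ.* fromℕ k   ≤⟨ *≤* (subst₂ ℤ._≤_ num den (ℤ.+≤+ km≤d)) ⟩
    1ℚᵘ             ≤⟨ 1≤tp ⟩
    t ℚ.* p         ∎)
  where
  open ℚ.≤-Reasoning
  q = mkℚᵘ (+ m) d
  num : + (k * m) ≡ + m ℤ.* + k ℤ.* + 1
  num = trans (cong +_ (*-comm k m)) (trans (ℤ.pos-* m k) (sym (ℤ.*-identityʳ _)))
  den : + suc d ≡ + 1 ℤ.* ℚ.↧ (q ℚ.* fromℕ k)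
  den = trans (cong (λ z → + suc z) (sym (*-identityʳ d))) (sym (ℤ.*-identityˡ _))

-- Choice of the constant C and of the parameters of the sparsification

corollary1p3 : (a c : ℝ⁺) →
    Σ[ C ∈ ℝ⁺ ]
    ((n : ℕ) .{{_ : NonZero n}} → 2 ≤ n →
    (f : Vec Bool n → Bool) (F : DNF n) → F computes f →
    fromℕ (width F) ≤ℝ a *ℝ log (fromℕ⁺ n) →
    Σ[ G ∈ DNF n ]
    (fromℕ (width G) ≤ℝ C *ℝ log (fromℕ⁺ n)) ×
    (fromℕ (length G) ≤ℝ n ^ℝ (C *ℝ log (log (fromℕ⁺ n)))) ×
    (Pr (λ x → ¬? (f x ≟ eval G x)) ≤ℝ (n ^ℝ c) ⁻¹))
corollary1p3 a c with inhabited a | inhabited c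
... | ra , ra∈a | rc , rc∈c = fromℕ⁺ K , result
  where
  A B K : ℕ
  -- `A` and `B` are natural upper bounds for a and c, a positive rational being at most its
  -- numerator.
  A = ℤ.∣ ↥ ra ∣
  B = ℤ.∣ ↥ rc ∣
  -- 4A + 2B is the exponent of 2 ^ L in the bound for s²; the successor makes `K` visibly nonzero.
  K = suc (4 * A + 2 * B)
  result : (n : ℕ) .{{_ : NonZero n}} → 2 ≤ n →
    (f : Vec Bool n → Bool) (F : DNF n) → F computes f →
    fromℕ (width F) ≤ℝ a *ℝ log (fromℕ⁺ n) →
    Σ[ G ∈ DNF n ]
    (fromℕ (width G) ≤ℝ fromℕ⁺ K *ℝ log (fromℕ⁺ n)) ×
    (fromℕ (length G) ≤ℝ n ^ℝ (fromℕ⁺ K *ℝ log (log (fromℕ⁺ n)))) ×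
    (Pr (λ x → ¬? (f x ≟ eval G x)) ≤ℝ (n ^ℝ c) ⁻¹)
  result n 2≤n f F F≈f width≤ with floor-log₂ n (≤-trans (s≤s z≤n) 2≤n)
  ... | zero , _ , n<2 = contradiction 2≤n (<⇒≱ n<2)
  -- As ℓ ≥ 1, the integer ℓ + 1 is at least max{2, log₂ n}, so `F` has width at most A(ℓ + 1). The
  -- error exponent e = B(ℓ + 1) gives 2ᵉ ≥ n ^ B.
  ... | ℓ@(suc _) , 2^ℓ≤n , n<2^L
    with sparsification (A * suc ℓ) (B * suc ℓ) f F F≈f
           (fromℕ-cancel-≤ (width≤ (*ℝ≤* {x = a} {y = log (fromℕ⁺ n)} (suc ℓ) ra∈a
             (log≤ (s≤s (s≤s z≤n)) (<⇒≤ n<2^L)))))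
  ... | G , widthG≤ , lengthG≤ , errors≤ = G ,
    (λ t∈ → ℚ.≤-trans (fromℕ-mono widthG≤Kℓ)
      (*≤*ℝ {x = fromℕ⁺ K} {log (fromℕ⁺ n)} (λ K≤ → K≤) (≤log 2^ℓ≤n) t∈)) ,
    (λ t∈ → ℚ.≤-trans (fromℕ-mono lengthG≤n^2K)
      (^≤^ℝ {x = fromℕ⁺ K *ℝ log (log (fromℕ⁺ n))}
        -- `proj₁` is the bound log log n ≥ 2, so n ^ (K * 2) terms are allowed.
        (*≤*ℝ {x = fromℕ⁺ K} {log (log (fromℕ⁺ n))} (λ K≤ → K≤) proj₁) t∈)) ,
    /≤⁻¹ {x = n ^ℝ c} errors (2 ^ n) {{m^n≢0 2 n}} (^ℝ≤^ {x = c} rc∈c)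
      (≤-trans (*-monoˡ-≤ errors n^B≤2^BL) errors≤)
    where
    open ≤-Reasoning
    L = suc ℓ
    errors = length (filter (λ x → ¬? (f x ≟ eval G x)) (cube n))
    -- Rounding log₂ n up to `L` costs at most a squaring, since 2 ≤ n.
    2^L≤n*n : 2 ^ L ≤ n * n
    2^L≤n*n = *-mono-≤ 2≤n 2^ℓ≤n
    n^B≤2^BL : n ^ B ≤ 2 ^ (B * L)
    n^B≤2^BL = begin
      n ^ B         ≤⟨ ^-monoˡ-≤ B (<⇒≤ n<2^L) ⟩
      (2 ^ L) ^ B   ≡⟨ ^-*-assoc 2 L B ⟩
      2 ^ (L * B)   ≡⟨ cong (2 ^_) (*-comm L B) ⟩
      2 ^ (B * L)   ∎
    widthG≤Kℓ : width G ≤ K * ℓ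
    widthG≤Kℓ = begin
      width G       ≤⟨ widthG≤ ⟩
      -- L = 1 + ℓ ≤ 2ℓ because ℓ ≥ 1.
      A * L         ≤⟨ *-monoʳ-≤ A (+-monoˡ-≤ ℓ (s≤s z≤n)) ⟩
      A * (ℓ + ℓ)   ≤⟨ m≤m+n _ (ℓ + (2 * A + 2 * B) * ℓ) ⟩
      A * (ℓ + ℓ) + (ℓ + (2 * A + 2 * B) * ℓ) ≡⟨ lem A B ℓ ⟩
      K * ℓ         ∎
      where
      lem : ∀ A B ℓ → A * (ℓ + ℓ) + (ℓ + (2 * A + 2 * B) * ℓ) ≡ suc (4 * A + 2 * B) * ℓ
      lem = solve-∀
    s≤ : 3 ^ (A * L) * 2 ^ (B * L) ≤ (2 ^ L) ^ (2 * A + B)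
    s≤ = begin
      -- Replacing 3 by 4 = 2² turns the whole product into a power of 2.
      3 ^ (A * L) * 2 ^ (B * L)         ≤⟨ *-monoˡ-≤ (2 ^ (B * L)) (^-monoˡ-≤ (A * L) (s≤s (s≤s (s≤s z≤n)))) ⟩
      4 ^ (A * L) * 2 ^ (B * L)         ≡⟨ cong (_* 2 ^ (B * L)) (^-*-assoc 2 2 (A * L)) ⟩
      2 ^ (2 * (A * L)) * 2 ^ (B * L)   ≡⟨ ^-distribˡ-+-* 2 (2 * (A * L)) (B * L) ⟨
      2 ^ (2 * (A * L) + B * L)         ≡⟨ cong (2 ^_) (lem A B L) ⟩
      2 ^ (L * (2 * A + B))             ≡⟨ ^-*-assoc 2 L (2 * A + B) ⟨
      (2 ^ L) ^ (2 * A + B)             ∎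
      where
      lem : ∀ A B L → 2 * (A * L) + B * L ≡ L * (2 * A + B)
      lem = solve-∀
    lengthG≤n^2K : length G ≤ n ^ (K * 2)
    lengthG≤n^2K = begin
      length G                                        ≤⟨ lengthG≤ ⟩
      _                                               ≤⟨ *-mono-≤ s≤ s≤ ⟩
      (2 ^ L) ^ (2 * A + B) * (2 ^ L) ^ (2 * A + B)   ≡⟨ ^-distribˡ-+-* (2 ^ L) (2 * A + B) (2 * A + B) ⟨
      (2 ^ L) ^ (2 * A + B + (2 * A + B))             ≤⟨ ^-monoʳ-≤ (2 ^ L) {{m^n≢0 2 L}} (≤-trans (≤-reflexive (lem A B)) (n≤1+n _)) ⟩
      (2 ^ L) ^ K                                     ≤⟨ ^-monoˡ-≤ K 2^L≤n*n ⟩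
      (n * n) ^ K                                     ≡⟨ cong (λ m → (n * m) ^ K) (*-identityʳ n) ⟨
      (n ^ 2) ^ K                                     ≡⟨ ^-*-assoc n 2 K ⟩
      n ^ (2 * K)                                     ≡⟨ cong (n ^_) (*-comm 2 K) ⟩
      n ^ (K * 2)                                     ∎
      where
      lem : ∀ A B → 2 * A + B + (2 * A + B) ≡ 4 * A + 2 * B
      lem = solve-∀
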